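{- $\mathsf{WLPO} \to \mathsf{AUC}_{\mathbb{N},\mathbb{B}} \to \mathsf{EA} \to \bot$; i.e. $\mathsf{WLPO}$, $\mathsf{AUC}_{\mathbb{N},\mathbb{B}}$ and $\mathsf{EA}$ are jointly contradictory.
   Context: Ambient theory: Coq's type theory (constructive, with a hierarchy of types $\mathbb{T}$ and a separate impredicative universe $\mathbb{P}$ of propositions), with no additional axioms. $\exists$ is propositional existence (eliminable in general only into propositions), $\Sigma$ the dependent pair type, $\mathbb{B}$ the type of booleans. $\mathsf{WLPO} := \forall f : \mathbb{N} \to \mathbb{B}.\ \neg\neg(\exists n.\ f\,n = \mathsf{true}) \lor \neg(\exists n.\ f\,n = \mathsf{true})$. $\mathsf{AUC}_{\mathbb{N},\mathbb{B}} := \forall R : \mathbb{N} \to \mathbb{B} \to \mathbb{P}.\ (\forall x.\,\exists! y.\ R\,x\,y) \to \exists f : \mathbb{N} \to \mathbb{B}.\ \forall x.\ R\,x\,(f\,x)$. $\mathsf{EA} := \Sigma \varphi : \mathbb{N} \to (\mathbb{N} \to \mathrm{option}\,\mathbb{N}).\ \forall f : \mathbb{N} \to \mathrm{option}\,\mathbb{N}.\ \exists c.\ \varphi\,c \equiv_{\mathsf{ran}} f$, where $f \equiv_{\mathsf{ran}} g := \forall x.\ (\exists n.\ f\,n = \mathrm{Some}\,x) \leftrightarrow (\exists n.\ g\,n = \mathrm{Some}\,x)$. -}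

module Defs where

open import Data.Bool.Base using (Bool; true)
open import Data.Empty using (⊥)
open import Data.Maybe.Base using (Maybe; just)
open import Data.Nat.Base using (ℕ)
open import Data.Product using (Σ-syntax; ∃-syntax; ∃!)
open import Data.Sum.Base using (_⊎_)
open import Function.Bundles using (_⇔_)
open import Relation.Binary.PropositionalEquality using (_≡_)
open import Relation.Nullary using (¬_)

-- A separate universe ℙ of propositions, as in Coq.  ∥ A ∥ is Coq's
-- `inhabited A`: it is eliminable only into propositions, except that falsity
-- ∥ ⊥ ∥ eliminates into every type.  Nothing provides a map Prf ∥ A ∥ → A, and
-- neither proof irrelevance, impredicativity nor any choice is assumed.
record PropositionalUniverse : Set₂ where
  field
    ℙ      : Set₁
    Prf    : ℙ → Set
    ∥_∥    : Set → ℙ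
    ∣_∣    : ∀ {A} → A → Prf ∥ A ∥
    ∥∥-rec : ∀ {A} (Q : ℙ) → (A → Prf Q) → Prf ∥ A ∥ → Prf Q
    ∥⊥∥    : Prf ∥ ⊥ ∥ → ⊥

-- Propositional existence is the inhabitedness of Σ, and disjunction that of ⊎.
-- With Σ and ⊎ themselves AUC would be a theorem.  The other connectives
-- are the plain type formers: their elimination is unrestricted in Coq as well.
module _ (𝒰 : PropositionalUniverse) where
  open PropositionalUniverse 𝒰

  WLPO : Set
  WLPO = ∀ (f : ℕ → Bool) →
    Prf ∥ ¬ ¬ Prf ∥ ∃[ n ] f n ≡ true ∥ ⊎ ¬ Prf ∥ ∃[ n ] f n ≡ true ∥ ∥

  AUC-ℕ-𝔹 : Set₁
  AUC-ℕ-𝔹 = ∀ (R : ℕ → Bool → ℙ) →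
    (∀ x → Prf ∥ ∃! _≡_ (λ y → Prf (R x y)) ∥) →
    Prf ∥ Σ[ f ∈ (ℕ → Bool) ] (∀ x → Prf (R x (f x))) ∥

  infix 4 _≡ᵣₐₙ_

  _≡ᵣₐₙ_ : (f g : ℕ → Maybe ℕ) → Set
  f ≡ᵣₐₙ g = ∀ x →
    Prf ∥ ∃[ n ] f n ≡ just x ∥ ⇔ Prf ∥ ∃[ n ] g n ≡ just x ∥

  EA : Set
  EA = Σ[ φ ∈ (ℕ → ℕ → Maybe ℕ) ]
    (∀ (f : ℕ → Maybe ℕ) → Prf ∥ ∃[ c ] φ c ≡ᵣₐₙ f ∥)

{-# OPTIONS --safe #-}

-- WLPO decides, up to ∥_∥, whether c lies outside the c-th enumerable set, and
-- AUC turns this into a Boolean function.  The diagonal complement is thus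
-- decidable, hence enumerable, and an index for it is contradictory.
module Submission where

open import Defs
open import Data.Bool.Base using (Bool; true; false; if_then_else_)
open import Data.Empty using (⊥; ⊥-elim)
open import Data.Maybe.Base using (Maybe; just; nothing)
open import Data.Maybe.Properties using (≡-dec; just-injective)
open import Data.Nat.Base using (ℕ)
open import Data.Nat.Properties using (_≟_)
open import Data.Product using (Σ-syntax; ∃-syntax; ∃!; _,_)
open import Data.Sum.Base using (_⊎_; inj₁; inj₂)
open import Function.Base using (_∘_)
open import Function.Bundles using (Equivalence)
open import Relation.Binary.PropositionalEquality using (_≡_; refl; cong; subst)
open import Relation.Nullary using (¬_; Dec; does; yes)
open import Relation.Nullary.Decidable using (dec-true)
open import Relation.Unary using (Pred; Decidable)

does-true : ∀ {A : Set} (a? : Dec A) → does a? ≡ true → A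
does-true (yes a) _ = a

-- A partial identity, so that its range is exactly the set decided by `d`.
enumerate : (ℕ → Bool) → ℕ → Maybe ℕ
enumerate d n = if d n then just n else nothing

enumerate-complete : ∀ d {x} → d x ≡ true → enumerate d x ≡ just x
enumerate-complete d {x} eq = cong (λ b → if b then just x else nothing) eq

-- The only value `enumerate d` can return at `n` is `n` itself, which forces `n` and `x` to agree.
enumerate-sound : ∀ d {x} n → enumerate d n ≡ just x → d x ≡ true
enumerate-sound d n eq with d n in dn
... | true = subst (λ m → d m ≡ true) (just-injective eq) dn

module _ (𝒰 : PropositionalUniverse) where
  open PropositionalUniverse 𝒰

  ∥∥-map : ∀ {A B} → (A → B) → Prf ∥ A ∥ → Prf ∥ B ∥
  ∥∥-map f = ∥∥-rec ∥ _ ∥ (∣_∣ ∘ f)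

  -- Since `∥ ⊥ ∥` eliminates into types, a truncated hypothesis may be opened whenever the goal is
  -- `⊥`.
  ∥∥-refute : ∀ {A} → ¬ A → ¬ Prf ∥ A ∥
  ∥∥-refute ¬a = ∥⊥∥ ∘ ∥∥-map ¬a

  WLPO-decidable : WLPO 𝒰 → {P : Pred ℕ _} → Decidable P →
    Prf ∥ ¬ ¬ Prf ∥ ∃[ n ] P n ∥ ⊎ ¬ Prf ∥ ∃[ n ] P n ∥ ∥
  WLPO-decidable wlpo {P} P? = ∥∥-map transport (wlpo (does ∘ P?))
    where
    ∃true⇒∃P : Prf ∥ ∃[ n ] does (P? n) ≡ true ∥ → Prf ∥ ∃[ n ] P n ∥
    ∃true⇒∃P = ∥∥-map λ (n , eq) → n , does-true (P? n) eq

    ∃P⇒∃true : Prf ∥ ∃[ n ] P n ∥ → Prf ∥ ∃[ n ] does (P? n) ≡ true ∥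
    ∃P⇒∃true = ∥∥-map λ (n , p) → n , dec-true (P? n) p

    transport : ¬ ¬ Prf ∥ ∃[ n ] does (P? n) ≡ true ∥ ⊎ ¬ Prf ∥ ∃[ n ] does (P? n) ≡ true ∥ →
      ¬ ¬ Prf ∥ ∃[ n ] P n ∥ ⊎ ¬ Prf ∥ ∃[ n ] P n ∥
    transport (inj₁ ¬¬p) = inj₁ λ ¬q → ¬¬p (¬q ∘ ∃true⇒∃P)
    transport (inj₂ ¬p)  = inj₂ (¬p ∘ ∃P⇒∃true)

  -- Truncated because AUC takes relations valued in `ℙ`, whereas a negation is a `Set`. The value
  -- `false` stands for `¬ ¬ A` rather than `A`, matching the first alternative of WLPO.
  DecidesNegation : Set → Bool → ℙ
  DecidesNegation A true  = ∥ ¬ A ∥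
  DecidesNegation A false = ∥ ¬ ¬ A ∥

  ¬-¬¬-absurd : ∀ {A} → Prf ∥ ¬ A ∥ → ¬ Prf ∥ ¬ ¬ A ∥
  ¬-¬¬-absurd p = ∥∥-refute λ ¬¬a → ∥∥-refute ¬¬a p

  -- The mixed cases hold because `¬ A` and `¬ ¬ A` refute each other even under truncation; this is
  -- the uniqueness demanded by AUC.
  DecidesNegation-unique : ∀ {A} b {b′} →
    Prf (DecidesNegation A b) → Prf (DecidesNegation A b′) → b ≡ b′
  DecidesNegation-unique true  {true}  _ _ = refl
  DecidesNegation-unique true  {false} p q = ⊥-elim (¬-¬¬-absurd p q)
  DecidesNegation-unique false {true}  p q = ⊥-elim (¬-¬¬-absurd q p)
  DecidesNegation-unique false {false} _ _ = refl

  DecidesNegation-∃! : ∀ {A} → ¬ ¬ A ⊎ ¬ A → ∃! _≡_ (λ b → Prf (DecidesNegation A b))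
  DecidesNegation-∃! (inj₁ ¬¬a) = false , ∣ ¬¬a ∣ , DecidesNegation-unique false ∣ ¬¬a ∣
  DecidesNegation-∃! (inj₂ ¬a)  = true , ∣ ¬a ∣ , DecidesNegation-unique true ∣ ¬a ∣

  Diagonal : (ℕ → ℕ → Maybe ℕ) → ℕ → Set
  Diagonal φ c = Prf ∥ ∃[ n ] φ c n ≡ just c ∥

  -- For fixed `c`, whether `φ c n` equals `just c` is decidable in `n`, so WLPO applies pointwise.
  -- The two exclusive alternatives give a unique Boolean at each `c`.
  diagonal-decider : WLPO 𝒰 → AUC-ℕ-𝔹 𝒰 → ∀ φ →
    Prf ∥ Σ[ d ∈ (ℕ → Bool) ] (∀ c → Prf (DecidesNegation (Diagonal φ c) (d c))) ∥
  diagonal-decider wlpo auc φ = auc (λ c → DecidesNegation (Diagonal φ c)) λ c →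
    ∥∥-map DecidesNegation-∃! (WLPO-decidable wlpo λ n → ≡-dec _≟_ (φ c n) (just c))

  diagonal-complement-not-enumerated : ∀ φ d →
    (∀ c → Prf (DecidesNegation (Diagonal φ c) (d c))) →
    ∀ c → ¬ (_≡ᵣₐₙ_ 𝒰 (φ c) (enumerate d))
  diagonal-complement-not-enumerated φ d spec c φc≡d with d c in dc | spec c
  -- Here `enumerate d` lists `c`, hence so does `φ c`, against `¬diag`.
  ... | true  | ¬diag  =
    ∥∥-refute (λ ¬w → ¬w (Equivalence.from (φc≡d c) ∣ c , enumerate-complete d dc ∣)) ¬diag
  -- Here `enumerate d` omits `c`, hence so does `φ c`, against `¬¬diag`.
  ... | false | ¬¬diag = ∥∥-refute (λ ¬¬w → ¬¬w (∥∥-refute not-enumerated ∘ Equivalence.to (φc≡d c))) ¬¬diag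
    where
    not-enumerated : ¬ (∃[ n ] enumerate d n ≡ just c)
    not-enumerated (n , eq) with () ← subst (_≡ true) dc (enumerate-sound d n eq)

corollary47 : (𝒰 : PropositionalUniverse) → WLPO 𝒰 → AUC-ℕ-𝔹 𝒰 → EA 𝒰 → ⊥
corollary47 𝒰 wlpo auc (φ , universal) =
  -- Both the decider and its index exist only under truncation, which suffices for the goal `⊥`.
  ∥∥-refute 𝒰
    (λ (d , spec) →
      ∥∥-refute 𝒰
        (λ (c , φc≡d) → diagonal-complement-not-enumerated 𝒰 φ d spec c φc≡d)
        (universal (enumerate d)))
    (diagonal-decider 𝒰 wlpo auc φ)
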